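{- For every integer $n\ge0$ and real $x$, $$\mathfrak{C}_{n+1}(x)=x\sum_{k=0}^{\lfloor n/2\rfloor}4^{ -k}\binom{n+1}{2k+1}\mathfrak{C}_{n-2k}(x).$$
   Context: For $n\ge1$ the central factorial is $x^{[n]}=x\,(x+\tfrac n2-1)(x+\tfrac n2-2)\cdots(x-\tfrac n2+1)$ (a product of $n$ factors), and $x^{[0]}=1$. The central factorial numbers of the second kind $T(n,k)$ ($0\le k\le n$) are defined by $x^n=\sum_{k=0}^n T(n,k)\,x^{[k]}$; equivalently $T(n,k)=\frac1{k!}\sum_{j=0}^k(-1)^j\binom kj\left(\frac k2-j\right)^n$, and $T(n,k)=0$ for $k>n$. The $n$th central Fubini-like polynomial is $\mathfrak{C}_n(x)=\sum_{k=0}^n k!\,T(n,k)\,x^k$. -}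

module Defs where

open import Algebra.Bundles using (CommutativeRing)
open import Algebra.Morphism.Structures using (module RingMorphisms)
import Algebra.Definitions.RawSemiring as RawSemiringDefinitions
import Algebra.Properties.Semiring.Exp as Exp
import Algebra.Properties.Semiring.Mult as Mult
import Algebra.Properties.Semiring.Sum as Sum
open import Data.Fin.Base using (toℕ)
import Data.Integer.Base as ℤ
import Data.Integer.Properties as ℤₚ
open import Data.Nat.Base as ℕ using (ℕ; zero; suc; _<_; s≤s; z≤n; _!)
import Data.Nat.Properties as ℕₚ
open import Data.Product.Base using (∃-syntax; _,_)
open import Data.Rational.Base as ℚ using (ℚ; 0ℚ; 1ℚ; _+_; _*_; _-_; _/_; toℚᵘ)
import Data.Rational.Properties as ℚₚ
open import Data.Rational.Solver using (module +-*-Solver)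
import Data.Rational.Unnormalised.Base as ℚᵘ
import Data.Rational.Unnormalised.Properties as ℚᵘₚ
open import Level using (_⊔_)
import Level
open import Relation.Binary.PropositionalEquality

open Sum (CommutativeRing.semiring ℚₚ.+-*-commutativeRing)
open RawSemiringDefinitions ℚ.+-*-rawSemiring using (_^_; product)

fromℕ : ℕ → ℚ
fromℕ n = ℤ.+ n / 1

-- x^[n] = x (x + n/2 - 1) (x + n/2 - 2) ⋯ (x - n/2 + 1), with n factors:
-- those after the first are x + n/2 - i for 1 ≤ i ≤ n - 1.
centralFactorial : ℚ → ℕ → ℚ
centralFactorial x zero    = 1ℚ
centralFactorial x (suc m) =
  x * product {m} (λ i → (x + ℤ.+ (suc m) / 2) - fromℕ (suc (toℕ i)))

-- The central factorial numbers T(n,k) of the second kind.  As ℚ is infinite,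
-- the expansion for all x : ℚ is the same as an identity of polynomials, so
-- these conditions determine T; existence is proved at the end of this module.
record IsCentralFactorialNumbers (T : ℕ → ℕ → ℚ) : Set where
  field
    expansion : ∀ n x → x ^ n ≡ ∑[ k ≤ n ] (T n (toℕ k) * centralFactorial x (toℕ k))
    vanishing : ∀ n k → n < k → T n k ≡ 0ℚ

-- The standard library has no real numbers; any model of ℝ is a commutative
-- ℚ-algebra via the inclusion ℚ → ℝ.
record ℚ-Algebra c ℓ : Set (Level.suc (c ⊔ ℓ)) where
  field
    commutativeRing : CommutativeRing c ℓ
  open CommutativeRing commutativeRing public
  field
    fromℚ              : ℚ → Carrier
    fromℚ-homomorphism : RingMorphisms.IsRingHomomorphism ℚ.+-*-rawRing rawRing fromℚ
  open Exp semiring public using (_^_)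
  open Mult semiring public using (_×_)
  open Sum semiring public using (sum; sum-syntax; sum⁺-syntax)

module _ {c ℓ} (A : ℚ-Algebra c ℓ) (T : ℕ → ℕ → ℚ) where
  private open module A = ℚ-Algebra A using (Carrier; fromℚ; _×_)

  -- The value at x of the polynomial Σ_{k ≤ n} k! T(n,k) x^k.
  centralFubini : ℕ → Carrier → Carrier
  centralFubini n x =
    A.sum {suc n} (λ k → ((toℕ k) !) × (fromℚ (T n (toℕ k)) A.* x A.^ toℕ k))

-- Existence of the central factorial numbers, by the recurrence coming from
-- x² x^[k] = x^[k+2] + (k/2)² x^[k].
private
  half : ℕ → ℚ
  half k = ℤ.+ k / 2

  T : ℕ → ℕ → ℚ
  T 0 0 = 1ℚ
  T 0 (suc k) = 0ℚ
  T 1 0 = 0ℚ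
  T 1 1 = 1ℚ
  T 1 (suc (suc k)) = 0ℚ
  T (suc (suc n)) 0 = half 0 * half 0 * T n 0
  T (suc (suc n)) 1 = half 1 * half 1 * T n 1
  T (suc (suc n)) (suc (suc k)) = T n k + half (2 ℕ.+ k) * half (2 ℕ.+ k) * T n (2 ℕ.+ k)

  T-vanishing : ∀ n k → n < k → T n k ≡ 0ℚ
  T-vanishing 0 (suc k) _ = refl
  T-vanishing 1 (suc (suc k)) _ = refl
  T-vanishing 1 1 (s≤s ())
  T-vanishing (suc (suc n)) 1 (s≤s ())
  T-vanishing (suc (suc n)) (suc (suc k)) (s≤s (s≤s n<k)) = begin
    T n k + h * T n (2 ℕ.+ k) ≡⟨ cong₂ (λ a b → a + h * b) (T-vanishing n k n<k)
                                  (T-vanishing n (2 ℕ.+ k) (ℕₚ.m≤n⇒m≤o+n 2 n<k)) ⟩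
    0ℚ + h * 0ℚ               ≡⟨ solve 1 (λ h → con 0ℚ :+ h :* con 0ℚ := con 0ℚ) refl h ⟩
    0ℚ                        ∎
    where
    open ≡-Reasoning
    open +-*-Solver
    h = half (2 ℕ.+ k) * half (2 ℕ.+ k)

  1-step : ∀ m → fromℕ (suc m) ≡ 1ℚ + fromℕ m
  1-step m = ℚₚ.toℚᵘ-injective (begin
    toℚᵘ (fromℕ (suc m))         ≈⟨ ℚₚ.toℚᵘ-fromℚᵘ (ℚᵘ.mkℚᵘ (ℤ.+ suc m) 0) ⟩
    ℚᵘ.mkℚᵘ (ℤ.+ suc m) 0          ≈⟨ ℚᵘ.*≡* (cong (λ z → (ℤ.+ 1 ℤ.+ z) ℤ.* ℤ.+ 1) (sym (ℤₚ.*-identityʳ (ℤ.+ m)))) ⟩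
    ℚᵘ.1ℚᵘ ℚᵘ.+ ℚᵘ.mkℚᵘ (ℤ.+ m) 0  ≈⟨ ℚᵘₚ.+-congʳ ℚᵘ.1ℚᵘ (ℚₚ.toℚᵘ-fromℚᵘ (ℚᵘ.mkℚᵘ (ℤ.+ m) 0)) ⟨
    ℚᵘ.1ℚᵘ ℚᵘ.+ toℚᵘ (fromℕ m)   ≈⟨ ℚₚ.toℚᵘ-homo-+ 1ℚ (fromℕ m) ⟨
    toℚᵘ (1ℚ + fromℕ m)          ∎)
    where open ℚᵘₚ.≃-Reasoning

  half-step : ∀ k → half (2 ℕ.+ k) ≡ 1ℚ + half k
  half-step k = ℚₚ.toℚᵘ-injective (begin
    toℚᵘ (half (2 ℕ.+ k))          ≈⟨ ℚₚ.toℚᵘ-fromℚᵘ (ℚᵘ.mkℚᵘ (ℤ.+ (2 ℕ.+ k)) 1) ⟩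
    ℚᵘ.mkℚᵘ (ℤ.+ (2 ℕ.+ k)) 1      ≈⟨ ℚᵘ.*≡* (cong (λ z → (ℤ.+ 2 ℤ.+ z) ℤ.* ℤ.+ 2) (sym (ℤₚ.*-identityʳ (ℤ.+ k)))) ⟩
    ℚᵘ.1ℚᵘ ℚᵘ.+ ℚᵘ.mkℚᵘ (ℤ.+ k) 1  ≈⟨ ℚᵘₚ.+-congʳ ℚᵘ.1ℚᵘ (ℚₚ.toℚᵘ-fromℚᵘ (ℚᵘ.mkℚᵘ (ℤ.+ k) 1)) ⟨
    ℚᵘ.1ℚᵘ ℚᵘ.+ toℚᵘ (half k)      ≈⟨ ℚₚ.toℚᵘ-homo-+ 1ℚ (half k) ⟨
    toℚᵘ (1ℚ + half k)             ∎)
    where open ℚᵘₚ.≃-Reasoning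

  half+half : ∀ k → half k + half k ≡ fromℕ k
  half+half 0 = refl
  half+half 1 = refl
  half+half (suc (suc k)) = begin
    half (2 ℕ.+ k) + half (2 ℕ.+ k)  ≡⟨ cong (λ h → h + h) (half-step k) ⟩
    (1ℚ + half k) + (1ℚ + half k)    ≡⟨ solve 1 (λ h → (con 1ℚ :+ h) :+ (con 1ℚ :+ h) :=
                                                       con 1ℚ :+ (con 1ℚ :+ (h :+ h))) refl (half k) ⟩
    1ℚ + (1ℚ + (half k + half k))    ≡⟨ cong (λ z → 1ℚ + (1ℚ + z)) (half+half k) ⟩
    1ℚ + (1ℚ + fromℕ k)            ≡⟨ cong (1ℚ +_) (1-step k) ⟨
    1ℚ + fromℕ (suc k)             ≡⟨ 1-step (suc k) ⟨
    fromℕ (2 ℕ.+ k)                ∎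
    where
    open ≡-Reasoning
    open +-*-Solver

  ∏ : (ℕ → ℚ) → ℕ → ℚ
  ∏ f n = product {n} (λ i → f (toℕ i))

  ∏-cong : ∀ {f g} → (∀ i → f i ≡ g i) → ∀ n → ∏ f n ≡ ∏ g n
  ∏-cong f≗g zero    = refl
  ∏-cong f≗g (suc n) = cong₂ _*_ (f≗g 0) (∏-cong (λ i → f≗g (suc i)) n)

  ∏-last : ∀ f n → ∏ f (suc n) ≡ ∏ f n * f n
  ∏-last f zero    = ℚₚ.*-comm (f 0) 1ℚ
  ∏-last f (suc n) = trans (cong (f 0 *_) (∏-last (λ i → f (suc i)) n)) (sym (ℚₚ.*-assoc (f 0) _ _))

  ∑ : (ℕ → ℚ) → ℕ → ℚ
  ∑ f n = sum {n} (λ i → f (toℕ i))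

  ∑-cong : ∀ {f g} → (∀ i → f i ≡ g i) → ∀ n → ∑ f n ≡ ∑ g n
  ∑-cong f≗g n = sum-cong-≗ {n} (λ i → f≗g (toℕ i))

  ∑-last : ∀ f n → ∑ f (suc n) ≡ ∑ f n + f n
  ∑-last f zero    = ℚₚ.+-comm (f 0) 0ℚ
  ∑-last f (suc n) = trans (cong (f 0 +_) (∑-last (λ i → f (suc i)) n)) (sym (ℚₚ.+-assoc (f 0) _ _))

  centralFactorial-step : ∀ x k →
    centralFactorial x (2 ℕ.+ k) ≡ centralFactorial x k * (x * x - half k * half k)
  centralFactorial-step x zero =
    solve 1 (λ x → x :* ((x :+ con 1ℚ :+ :- con 1ℚ) :* con 1ℚ) :=
                   con 1ℚ :* (x :* x :+ :- (con 0ℚ :* con 0ℚ))) refl x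
    where open +-*-Solver
  centralFactorial-step x (suc m) = begin
    x * ((x + half (3 ℕ.+ m) - 1ℚ) * ∏ (λ i → x + half (3 ℕ.+ m) - fromℕ (2 ℕ.+ i)) (suc m))
      ≡⟨ cong (x *_) (cong₂ _*_ first (∏-cong shift (suc m))) ⟩
    x * ((x + h) * ∏ f (suc m))
      ≡⟨ cong (λ z → x * ((x + h) * z)) (∏-last f m) ⟩
    x * ((x + h) * (∏ f m * (x + h - fromℕ (suc m))))
      ≡⟨ cong (λ z → x * ((x + h) * (∏ f m * (x + h - z)))) (half+half (suc m)) ⟨
    x * ((x + h) * (∏ f m * (x + h - (h + h))))
      ≡⟨ solve 3 (λ x h p → x :* ((x :+ h) :* (p :* (x :+ h :+ :- (h :+ h)))) :=
                            x :* p :* (x :* x :+ :- (h :* h))) refl x h (∏ f m) ⟩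
    x * ∏ f m * (x * x - h * h) ∎
    where
    open ≡-Reasoning
    open +-*-Solver
    h = half (suc m)
    f : ℕ → ℚ
    f i = x + h - fromℕ (suc i)
    first : x + half (3 ℕ.+ m) - 1ℚ ≡ x + h
    first = trans (cong (λ z → x + z - 1ℚ) (half-step (suc m)))
      (solve 2 (λ x h → x :+ (con 1ℚ :+ h) :+ :- con 1ℚ := x :+ h) refl x h)
    shift : ∀ i → x + half (3 ℕ.+ m) - fromℕ (2 ℕ.+ i) ≡ f i
    shift i = trans (cong₂ (λ y z → x + y - z) (half-step (suc m)) (1-step (suc i)))
      (solve 3 (λ x h j → x :+ (con 1ℚ :+ h) :+ :- (con 1ℚ :+ j) := x :+ h :+ :- j)
        refl x h (fromℕ (suc i)))

  T-expansion : ∀ n x → x ^ n ≡ ∑ (λ k → T n k * centralFactorial x k) (suc n)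
  T-expansion 0 x = refl
  T-expansion 1 x =
    solve 1 (λ x → x :* con 1ℚ := con 0ℚ :* con 1ℚ :+ (con 1ℚ :* (x :* con 1ℚ) :+ con 0ℚ)) refl x
    where open +-*-Solver
  T-expansion (suc (suc n)) x = begin
    x * (x * x ^ n)
      ≡⟨ ℚₚ.*-assoc x x (x ^ n) ⟨
    x * x * x ^ n
      ≡⟨ cong (x * x *_) (T-expansion n x) ⟩
    x * x * ∑ (λ k → T n k * c k) (suc n)
      ≡⟨ *-distribˡ-sum {suc n} (x * x) (λ i → T n (toℕ i) * c (toℕ i)) ⟩
    ∑ (λ k → x * x * (T n k * c k)) (suc n)
      ≡⟨ ∑-cong split (suc n) ⟩
    ∑ (λ k → a k + b k) (suc n)
      ≡⟨ ∑-distrib-+ {suc n} (λ i → a (toℕ i)) (λ i → b (toℕ i)) ⟩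
    ∑ a (suc n) + ∑ b (suc n)
      ≡⟨ cong (∑ a (suc n) +_) (trans (extend (suc n) ℕₚ.≤-refl) (extend (2 ℕ.+ n) (ℕₚ.n≤1+n _))) ⟩
    ∑ a (suc n) + (b 0 + (b 1 + ∑ (λ k → b (2 ℕ.+ k)) (suc n)))
      ≡⟨ solve 4 (λ a p q r → a :+ (p :+ (q :+ r)) := p :+ (q :+ (a :+ r))) refl (∑ a (suc n)) (b 0) (b 1) (∑ (λ k → b (2 ℕ.+ k)) (suc n)) ⟩
    b 0 + (b 1 + (∑ a (suc n) + ∑ (λ k → b (2 ℕ.+ k)) (suc n)))
      ≡⟨ cong (λ z → b 0 + (b 1 + z)) (∑-distrib-+ {suc n} (λ i → a (toℕ i)) (λ i → b (2 ℕ.+ toℕ i))) ⟨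
    b 0 + (b 1 + ∑ (λ k → a k + b (2 ℕ.+ k)) (suc n))
      ≡⟨ cong (λ z → b 0 + (b 1 + z)) (∑-cong merge (suc n)) ⟩
    ∑ (λ k → T (2 ℕ.+ n) k * c k) (3 ℕ.+ n) ∎
    where
    open ≡-Reasoning
    open +-*-Solver
    c = centralFactorial x
    a b : ℕ → ℚ
    a k = T n k * c (2 ℕ.+ k)
    b k = half k * half k * T n k * c k
    split : ∀ k → x * x * (T n k * c k) ≡ a k + b k
    split k = trans
      (solve 4 (λ x h t c → x :* x :* (t :* c) :=
                            t :* (c :* (x :* x :+ :- (h :* h))) :+ h :* h :* t :* c)
        refl x (half k) (T n k) (c k))
      (cong (λ z → T n k * z + b k) (sym (centralFactorial-step x k)))
    merge : ∀ k → a k + b (2 ℕ.+ k) ≡ T (2 ℕ.+ n) (2 ℕ.+ k) * c (2 ℕ.+ k)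
    merge k = sym (ℚₚ.*-distribʳ-+ (c (2 ℕ.+ k)) (T n k)
                                   (half (2 ℕ.+ k) * half (2 ℕ.+ k) * T n (2 ℕ.+ k)))
    extend : ∀ m → n < m → ∑ b m ≡ ∑ b (suc m)
    extend m n<m = sym (begin
      ∑ b (suc m)                              ≡⟨ ∑-last b m ⟩
      ∑ b m + half m * half m * T n m * c m    ≡⟨ cong (λ t → ∑ b m + half m * half m * t * c m) (T-vanishing n m n<m) ⟩
      ∑ b m + half m * half m * 0ℚ * c m       ≡⟨ solve 3 (λ s h c → s :+ h :* h :* con 0ℚ :* c := s)
                                                    refl (∑ b m) (half m) (c m) ⟩
      ∑ b m                                    ∎)

centralFactorialNumbers : ∃[ T ] IsCentralFactorialNumbers T
centralFactorialNumbers = T , record { expansion = T-expansion ; vanishing = T-vanishing }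

{-# OPTIONS --safe #-}

-- Apply the central difference δf(x) = f(x + ½) − f(x − ½) to the expansion
-- of x^{n+1} in central factorials.  As δ x^[k+1] = (k+1) x^[k], while by the
-- binomial theorem δ x^{n+1} = Σ_j 4^{-j} C(n+1,2j+1) x^{n−2j}, comparing the
-- coefficients of x^[k] gives
--   (k+1) T(n+1,k+1) = Σ_j 4^{-j} C(n+1,2j+1) T(n−2j,k),
-- and the theorem is k! times this, multiplied by x^{k+1} and summed over k.
module Submission where

open import Defs
open import Algebra.Bundles using (CommutativeRing; Semiring)
import Algebra.Morphism.Structures as Morphism
import Algebra.Properties.CommutativeSemiring.Binomial as Binomial
import Algebra.Properties.Semiring.Exp as Exp
import Algebra.Properties.Semiring.Mult as Mult
import Algebra.Properties.Semiring.Sum as Sum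
open import Data.Fin.Base using (toℕ)
open import Data.Integer.Base using (+_)
import Data.Integer.Base as ℤ
import Data.Integer.Properties as ℤₚ
import Data.Integer.Solver as ℤ-Solver
open import Data.Nat.Base as ℕ using (ℕ; suc; _∸_; ⌊_/2⌋)
open import Data.Nat.Base using (zero; _!; _<_; _≤_; z≤n; s≤s)
open import Data.Nat.Combinatorics using (_C_)
import Data.Nat.Properties as ℕₚ
open import Data.Rational.Base using (ℚ; _/_)
import Data.Rational.Base as ℚ
import Data.Rational.Properties as ℚₚ
import Data.Rational.Solver as ℚ-Solver
import Data.Rational.Unnormalised.Base as ℚᵘ
import Data.Rational.Unnormalised.Properties as ℚᵘₚ
open import Relation.Binary.PropositionalEquality as ≡ using (_≡_; cong; cong₂)

-- Finite sums over a semiring.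

module FiniteSum {c ℓ} (R : Semiring c ℓ) where
  open Semiring R renaming (zero to *-zero)
  open Sum R
  open Mult R
  open import Relation.Binary.Reasoning.Setoid setoid

  ∑ : (ℕ → Carrier) → ℕ → Carrier
  ∑ f n = sum {n} (λ i → f (toℕ i))

  ∑-cong : ∀ {f g} → (∀ i → f i ≈ g i) → ∀ n → ∑ f n ≈ ∑ g n
  ∑-cong f≈g n = sum-cong-≋ {n} (λ i → f≈g (toℕ i))

  ∑-cong-< : ∀ {f g} n → (∀ i → i < n → f i ≈ g i) → ∑ f n ≈ ∑ g n
  ∑-cong-< zero    f≈g = refl
  ∑-cong-< (suc n) f≈g = +-cong (f≈g 0 (s≤s z≤n)) (∑-cong-< n (λ i i<n → f≈g (suc i) (s≤s i<n)))

  ∑-zero : ∀ {f} n → (∀ i → f i ≈ 0#) → ∑ f n ≈ 0#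
  ∑-zero n f≈0 = trans (∑-cong f≈0 n) (sum-replicate-zero n)

  ∑-extend : ∀ {f m n} → m ≤ n → (∀ i → m ≤ i → f i ≈ 0#) → ∑ f m ≈ ∑ f n
  ∑-extend {n = n} z≤n f≈0 = sym (∑-zero n (λ i → f≈0 i z≤n))
  ∑-extend (s≤s m≤n) f≈0 = +-congˡ (∑-extend m≤n (λ i m≤i → f≈0 (suc i) (s≤s m≤i)))

  -- Induction in steps of two: each step drops one vanishing even term and keeps one odd term. The
  -- top index on the left is n+1, and 2j+1 ≤ n+1 means j ≤ ⌊n/2⌋; for odd n the top term is even
  -- and drops out as well.
  ∑-odd : ∀ f → (∀ j → f (2 ℕ.* j) ≈ 0#) →
          ∀ n → ∑ f (2 ℕ.+ n) ≈ ∑ (λ j → f (suc (2 ℕ.* j))) (suc ⌊ n /2⌋)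
  ∑-odd f f≈0 0 = trans (+-congʳ (f≈0 0)) (+-identityˡ _)
  ∑-odd f f≈0 1 = begin
    f 0 + (f 1 + (f 2 + 0#))  ≈⟨ +-cong (f≈0 0) (+-congˡ (trans (+-identityʳ _) (f≈0 1))) ⟩
    0# + (f 1 + 0#)           ≈⟨ +-identityˡ _ ⟩
    f 1 + 0#                  ∎
  ∑-odd f f≈0 (suc (suc n)) = begin
    f 0 + (f 1 + ∑ (λ i → f (2 ℕ.+ i)) (2 ℕ.+ n))
      ≈⟨ trans (+-congʳ (f≈0 0)) (+-identityˡ _) ⟩
    f 1 + ∑ (λ i → f (2 ℕ.+ i)) (2 ℕ.+ n)
      ≈⟨ +-congˡ (∑-odd (λ i → f (2 ℕ.+ i)) (λ j → trans (shift j) (f≈0 (suc j))) n) ⟩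
    f 1 + ∑ (λ j → f (3 ℕ.+ 2 ℕ.* j)) (suc ⌊ n /2⌋)
      ≈⟨ +-congˡ (∑-cong (λ j → reflexive (cong (λ m → f (suc m)) (≡.sym (ℕₚ.*-suc 2 j)))) (suc ⌊ n /2⌋)) ⟩
    f 1 + ∑ (λ j → f (suc (2 ℕ.* suc j))) (suc ⌊ n /2⌋) ∎
    where
    shift : ∀ j → f (2 ℕ.+ 2 ℕ.* j) ≈ f (2 ℕ.* suc j)
    shift j = reflexive (cong f (≡.sym (ℕₚ.*-suc 2 j)))

  -- Collects a linear combination of expansions in the family `y` into a single expansion. It
  -- serves twice: in ℚ with `y` the central factorials, and in the algebra with `y` the powers of
  -- x.
  ∑-exchange : ∀ (u : ℕ → Carrier) (c : ℕ → ℕ) (t : ℕ → ℕ → Carrier) (y : ℕ → Carrier) m n →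
    ∑ (λ j → u j * (c j × ∑ (λ k → t j k * y k) n)) m ≈
    ∑ (λ k → ∑ (λ j → u j * (c j × t j k)) m * y k) n
  ∑-exchange u c t y m n = begin
    ∑ (λ j → u j * (c j × ∑ (λ k → t j k * y k) n)) m
      -- The multiple `c j ×` is written as the factor `c j × 1#`, so that distributivity applies to
      -- one product; the factor is turned back after the sums are swapped.
      ≈⟨ ∑-cong (λ j → trans (sym (×-assocʳ-* j _))
           (*-distribˡ-sum {n} (u j * (c j × 1#)) (λ k → t j (toℕ k) * y (toℕ k)))) m ⟩
    ∑ (λ j → ∑ (λ k → (u j * (c j × 1#)) * (t j k * y k)) n) m
      ≈⟨ ∑-comm {m} {n} (λ j k → (u (toℕ j) * (c (toℕ j) × 1#)) * (t (toℕ j) (toℕ k) * y (toℕ k))) ⟩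
    ∑ (λ k → ∑ (λ j → (u j * (c j × 1#)) * (t j k * y k)) m) n
      ≈⟨ ∑-cong (λ k → trans
           (∑-cong (λ j → trans (sym (*-assoc _ _ _)) (*-congʳ (×-assocʳ-* j (t j k)))) m)
           (sym (*-distribʳ-sum {m} (y k) (λ j → u (toℕ j) * (c (toℕ j) × t (toℕ j) k))))) n ⟩
    ∑ (λ k → ∑ (λ j → u j * (c j × t j k)) m * y k) n ∎
    where
    ×-assocʳ-* : ∀ j z → (u j * (c j × 1#)) * z ≈ u j * (c j × z)
    ×-assocʳ-* j z = trans (*-assoc _ _ _)
      (*-congˡ (trans (×-assoc-* (c j) 1# z) (×-congʳ (c j) (*-identityˡ z))))

-- Rational arithmetic.

module _ where
  open import Data.Rational.Base using (_+_; _*_; _-_; -_; 0ℚ; 1ℚ; ½)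
  open CommutativeRing ℚₚ.+-*-commutativeRing using (semiring; commutativeSemiring)
  open FiniteSum semiring
  open Sum semiring using (*-distribˡ-sum)
  open Exp semiring using (_^_; ^-assocʳ)
  open Mult semiring using (_×_; ×-congʳ; ×-comm-*; ×-assocˡ)
  open import Algebra.Definitions.RawSemiring ℚ.+-*-rawSemiring using (product)
  open ≡.≡-Reasoning
  open ℚ-Solver.+-*-Solver

  -- Normalised fractions with variable numerators do not compute, so the equation is checked by
  -- cross multiplication of unnormalised ones.
  /-distribʳ-+ : ∀ i j d .{{_ : ℕ.NonZero d}} → (i ℤ.+ j) / d ≡ i / d + j / d
  /-distribʳ-+ i j (suc e) = ℚₚ.toℚᵘ-injective (ℚᵘₚ.≃-trans (ℚₚ.toℚᵘ-fromℚᵘ (ℚᵘ.mkℚᵘ (i ℤ.+ j) e))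
    (ℚᵘₚ.≃-trans (ℚᵘ.*≡* cross)
    (ℚᵘₚ.≃-sym (ℚᵘₚ.≃-trans (ℚₚ.toℚᵘ-homo-+ (i / suc e) (j / suc e))
      (ℚᵘₚ.+-cong (ℚₚ.toℚᵘ-fromℚᵘ (ℚᵘ.mkℚᵘ i e)) (ℚₚ.toℚᵘ-fromℚᵘ (ℚᵘ.mkℚᵘ j e)))))))
    where
    cross : (i ℤ.+ j) ℤ.* + (suc e ℕ.* suc e) ≡ (i ℤ.* + suc e ℤ.+ j ℤ.* + suc e) ℤ.* + suc e
    cross = ≡.trans (cong ((i ℤ.+ j) ℤ.*_) (ℤₚ.pos-* (suc e) (suc e)))
      (S.solve 3 (λ i j d → (i S.:+ j) S.:* (d S.:* d) S.:= (i S.:* d S.:+ j S.:* d) S.:* d)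
        ≡.refl i j (+ suc e))
      where module S = ℤ-Solver.+-*-Solver

  fromℕ-suc : ∀ n → fromℕ (suc n) ≡ 1ℚ + fromℕ n
  fromℕ-suc n = /-distribʳ-+ (+ 1) (+ n) 1

  half-suc : ∀ n → + suc n / 2 ≡ ½ + + n / 2
  half-suc n = /-distribʳ-+ (+ 1) (+ n) 2

  half+half : ∀ n → + n / 2 + + n / 2 ≡ fromℕ n
  half+half zero    = ≡.refl
  half+half (suc n) = begin
    + suc n / 2 + + suc n / 2        ≡⟨ cong (λ h → h + h) (half-suc n) ⟩
    (½ + + n / 2) + (½ + + n / 2)    ≡⟨ solve 1 (λ h → (con ½ :+ h) :+ (con ½ :+ h) :=
                                                       con 1ℚ :+ (h :+ h)) ≡.refl (+ n / 2) ⟩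
    1ℚ + (+ n / 2 + + n / 2)         ≡⟨ cong (λ z → 1ℚ + z) (half+half n) ⟩
    1ℚ + fromℕ n                     ≡⟨ fromℕ-suc n ⟨
    fromℕ (suc n)                    ∎

  fromℕ-* : ∀ n q → q * fromℕ n ≡ n × q
  fromℕ-* zero    q = ℚₚ.*-zeroʳ q
  fromℕ-* (suc n) q = begin
    q * fromℕ (suc n)   ≡⟨ cong (q *_) (fromℕ-suc n) ⟩
    q * (1ℚ + fromℕ n)  ≡⟨ solve 2 (λ q m → q :* (con 1ℚ :+ m) := q :+ q :* m) ≡.refl q (fromℕ n) ⟩
    q + q * fromℕ n     ≡⟨ cong (λ z → q + z) (fromℕ-* n q) ⟩
    q + n × q           ∎

  -- The factor is positive, so it cancels from the two inequalities that make up the equation.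
  *-cancelʳ-fromℕ : ∀ n {p q} → p * fromℕ (suc n) ≡ q * fromℕ (suc n) → p ≡ q
  *-cancelʳ-fromℕ n eq = ℚₚ.≤-antisym
    (ℚₚ.*-cancelʳ-≤-pos (fromℕ (suc n)) (ℚₚ.≤-reflexive eq))
    (ℚₚ.*-cancelʳ-≤-pos (fromℕ (suc n)) (ℚₚ.≤-reflexive (≡.sym eq)))
    where instance _ = ℚₚ.normalize-pos (suc n) 1

  -- The central difference of central factorials and of powers.

  ∑-distrib-- : ∀ f g n → ∑ f n - ∑ g n ≡ ∑ (λ i → f i - g i) n
  ∑-distrib-- f g zero    = ≡.refl
  ∑-distrib-- f g (suc n) = ≡.trans
    (solve 4 (λ a b c d → (a :+ b) :+ :- (c :+ d) := (a :+ :- c) :+ (b :+ :- d)) ≡.refl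
      (f 0) (∑ (λ i → f (suc i)) n) (g 0) (∑ (λ i → g (suc i)) n))
    (cong (λ z → f 0 - g 0 + z) (∑-distrib-- (λ i → f (suc i)) (λ i → g (suc i)) n))

  -- The shift stands to the left of x so that in the binomial theorem it carries the exponent k and
  -- x the complementary one.
  δ : (ℚ → ℚ) → ℚ → ℚ
  δ f x = f (½ + x) - f (- ½ + x)

  private
    ∏ : (ℕ → ℚ) → ℕ → ℚ
    ∏ f n = product {n} (λ i → f (toℕ i))

    ∏-cong : ∀ {f g} → (∀ i → f i ≡ g i) → ∀ n → ∏ f n ≡ ∏ g n
    ∏-cong f≗g zero    = ≡.refl
    ∏-cong f≗g (suc n) = cong₂ _*_ (f≗g 0) (∏-cong (λ i → f≗g (suc i)) n)

    ∏-last : ∀ f n → ∏ f (suc n) ≡ ∏ f n * f n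
    ∏-last f zero    = ℚₚ.*-comm (f 0) 1ℚ
    ∏-last f (suc n) = ≡.trans (cong (f 0 *_) (∏-last (λ i → f (suc i)) n))
                               (≡.sym (ℚₚ.*-assoc (f 0) _ _))

  -- Let k = m+1 and h = k/2. Removing the first factor of the product shifted up, or the last of
  -- the one shifted down, leaves the same product `P`. The rest is (x+½)(x+h) - (x-½)(x-h) =
  -- (1+2h)x, where 1+2h = k+1 and x times `P` is x^[k].
  δ-centralFactorial : ∀ k x →
    δ (λ y → centralFactorial y (suc k)) x ≡ fromℕ (suc k) * centralFactorial x k
  δ-centralFactorial zero x =
    solve 1 (λ x → (con ½ :+ x) :* con 1ℚ :+ :- ((:- con ½ :+ x) :* con 1ℚ) := con 1ℚ :* con 1ℚ)
      ≡.refl x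
  δ-centralFactorial (suc m) x = begin
    (½ + x) * (((½ + x) + + (2 ℕ.+ m) / 2 - 1ℚ) * ∏ (λ i → ((½ + x) + + (2 ℕ.+ m) / 2) - fromℕ (2 ℕ.+ i)) m)
      - (- ½ + x) * ∏ (λ i → ((- ½ + x) + + (2 ℕ.+ m) / 2) - fromℕ (suc i)) (suc m)
      ≡⟨ cong₂ (λ p q → (½ + x) * p - (- ½ + x) * q)
           (cong₂ _*_ first (∏-cong upper m)) (≡.trans (∏-cong lower (suc m)) (∏-last f m)) ⟩
    (½ + x) * ((x + h) * P) - (- ½ + x) * (P * (x + h - fromℕ (suc m)))
      -- With m+1 written as h+h the last factor becomes x-h, and a polynomial identity in x, h and
      -- `P` remains.
      ≡⟨ cong (λ z → (½ + x) * ((x + h) * P) - (- ½ + x) * (P * (x + h - z))) (half+half (suc m)) ⟨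
    (½ + x) * ((x + h) * P) - (- ½ + x) * (P * (x + h - (h + h)))
      ≡⟨ solve 3 (λ x h p → (con ½ :+ x) :* ((x :+ h) :* p)
                              :+ :- ((:- con ½ :+ x) :* (p :* (x :+ h :+ :- (h :+ h)))) :=
                            (con 1ℚ :+ (h :+ h)) :* (x :* p)) ≡.refl x h P ⟩
    (1ℚ + (h + h)) * (x * P)
      ≡⟨ cong (_* (x * P)) (≡.trans (cong (λ z → 1ℚ + z) (half+half (suc m))) (≡.sym (fromℕ-suc (suc m)))) ⟩
    fromℕ (2 ℕ.+ m) * (x * P) ∎
    where
    h = + suc m / 2
    f : ℕ → ℚ
    f i = (x + h) - fromℕ (suc i)
    P = ∏ f m
    first : (½ + x) + + (2 ℕ.+ m) / 2 - 1ℚ ≡ x + h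
    first = ≡.trans (cong (λ z → (½ + x) + z - 1ℚ) (half-suc (suc m)))
      (solve 2 (λ x h → (con ½ :+ x) :+ (con ½ :+ h) :+ :- con 1ℚ := x :+ h) ≡.refl x h)
    upper : ∀ i → ((½ + x) + + (2 ℕ.+ m) / 2) - fromℕ (2 ℕ.+ i) ≡ f i
    upper i = ≡.trans (cong₂ (λ y z → (½ + x) + y - z) (half-suc (suc m)) (fromℕ-suc (suc i)))
      (solve 3 (λ x h j → (con ½ :+ x) :+ (con ½ :+ h) :+ :- (con 1ℚ :+ j) := (x :+ h) :+ :- j)
        ≡.refl x h (fromℕ (suc i)))
    lower : ∀ i → ((- ½ + x) + + (2 ℕ.+ m) / 2) - fromℕ (suc i) ≡ f i
    lower i = ≡.trans (cong (λ y → (- ½ + x) + y - fromℕ (suc i)) (half-suc (suc m)))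
      (solve 3 (λ x h j → (:- con ½ :+ x) :+ (con ½ :+ h) :+ :- j := (x :+ h) :+ :- j)
        ≡.refl x h (fromℕ (suc i)))

  -- The powers of ½ and -½ agree at even exponents, so only k = 2j+1 survives, where ½·4^(-j) +
  -- ½·4^(-j) = 4^(-j).
  δ-^ : ∀ n x → δ (_^ suc n) x ≡
    ∑ (λ j → (+ 1 / 4) ^ j * ((suc n C suc (2 ℕ.* j)) × x ^ (n ∸ 2 ℕ.* j))) (suc ⌊ n /2⌋)
  δ-^ n x = begin
    (½ + x) ^ suc n - (- ½ + x) ^ suc n
      ≡⟨ cong₂ _-_ (Binomial.theorem commutativeSemiring (suc n) ½ x)
                   (Binomial.theorem commutativeSemiring (suc n) (- ½) x) ⟩
    ∑ (term ½) (2 ℕ.+ n) - ∑ (term (- ½)) (2 ℕ.+ n)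
      ≡⟨ ∑-distrib-- (term ½) (term (- ½)) (2 ℕ.+ n) ⟩
    ∑ (λ k → term ½ k - term (- ½) k) (2 ℕ.+ n)
      ≡⟨ ∑-cong factor (2 ℕ.+ n) ⟩
    ∑ (λ k → (½ ^ k - (- ½) ^ k) * y k) (2 ℕ.+ n)
      ≡⟨ ∑-odd (λ k → (½ ^ k - (- ½) ^ k) * y k) (λ j → ≡.trans (cong (_* y (2 ℕ.* j)) (even j)) (ℚₚ.*-zeroˡ (y (2 ℕ.* j)))) n ⟩
    ∑ (λ j → (½ ^ suc (2 ℕ.* j) - (- ½) ^ suc (2 ℕ.* j)) * y (suc (2 ℕ.* j))) (suc ⌊ n /2⌋)
      ≡⟨ ∑-cong (λ j → cong (_* y (suc (2 ℕ.* j))) (odd j)) (suc ⌊ n /2⌋) ⟩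
    -- `suc n ∸ suc (2 ℕ.* j)` computes to `n ∸ 2 ℕ.* j`, so `y` at odd indices already has the
    -- required form.
    ∑ (λ j → (+ 1 / 4) ^ j * y (suc (2 ℕ.* j))) (suc ⌊ n /2⌋) ∎
    where
    y : ℕ → ℚ
    y k = (suc n C k) × x ^ (suc n ∸ k)
    term : ℚ → ℕ → ℚ
    term h k = (suc n C k) × (h ^ k * x ^ (suc n ∸ k))
    factor : ∀ k → term ½ k - term (- ½) k ≡ (½ ^ k - (- ½) ^ k) * y k
    factor k = ≡.trans
      (≡.sym (cong₂ _-_ (×-comm-* (suc n C k) (½ ^ k) _) (×-comm-* (suc n C k) ((- ½) ^ k) _)))
      (solve 3 (λ a b y → a :* y :+ :- (b :* y) := (a :+ :- b) :* y) ≡.refl (½ ^ k) ((- ½) ^ k) (y k))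
    -- The squares of ½ and of -½ both compute to 1/4.
    ½^2j : ∀ j → ½ ^ (2 ℕ.* j) ≡ (+ 1 / 4) ^ j
    ½^2j j = ≡.sym (^-assocʳ ½ 2 j)
    -½^2j : ∀ j → (- ½) ^ (2 ℕ.* j) ≡ (+ 1 / 4) ^ j
    -½^2j j = ≡.sym (^-assocʳ (- ½) 2 j)
    even : ∀ j → ½ ^ (2 ℕ.* j) - (- ½) ^ (2 ℕ.* j) ≡ 0ℚ
    even j = ≡.trans (cong₂ _-_ (½^2j j) (-½^2j j)) (ℚₚ.+-inverseʳ ((+ 1 / 4) ^ j))
    odd : ∀ j → ½ ^ suc (2 ℕ.* j) - (- ½) ^ suc (2 ℕ.* j) ≡ (+ 1 / 4) ^ j
    odd j = ≡.trans (cong₂ (λ a b → ½ * a - (- ½) * b) (½^2j j) (-½^2j j))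
      (solve 1 (λ q → con ½ :* q :+ :- (:- con ½ :* q) := q) ≡.refl ((+ 1 / 4) ^ j))

  -- Expansions in central factorials and the uniqueness of their coefficients.

  centralExpansion : (ℕ → ℚ) → ℕ → ℚ → ℚ
  centralExpansion a n x = ∑ (λ k → a k * centralFactorial x k) n

  -- Every x^[k] with k ≥ 1 has the factor x and vanishes at 0; `r` collects its other factors
  -- there.
  centralExpansion-0 : ∀ a n → centralExpansion a (suc n) 0ℚ ≡ a 0
  centralExpansion-0 a n = begin
    a 0 * 1ℚ + ∑ (λ k → a (suc k) * (0ℚ * r k)) n
      ≡⟨ cong (λ z → a 0 * 1ℚ + z) (∑-zero n (λ k →
           solve 2 (λ a r → a :* (con 0ℚ :* r) := con 0ℚ) ≡.refl (a (suc k)) (r k))) ⟩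
    a 0 * 1ℚ + 0ℚ
      ≡⟨ solve 1 (λ a → a :* con 1ℚ :+ con 0ℚ := a) ≡.refl (a 0) ⟩
    a 0 ∎
    where
    r : ℕ → ℚ
    r m = product {m} (λ i → (0ℚ + + suc m / 2) - fromℕ (suc (toℕ i)))

  -- The constant term cancels and every other index drops by one, so `δ` acts here as the
  -- derivative does on power expansions.
  δ-centralExpansion : ∀ a n x →
    δ (centralExpansion a (suc n)) x ≡ centralExpansion (λ k → a (suc k) * fromℕ (suc k)) n x
  δ-centralExpansion a n x = begin
    (a 0 * 1ℚ + ∑ (u (½ + x)) n) - (a 0 * 1ℚ + ∑ (u (- ½ + x)) n)
      ≡⟨ solve 3 (λ a p q → (a :+ p) :+ :- (a :+ q) := p :+ :- q) ≡.refl
           (a 0 * 1ℚ) (∑ (u (½ + x)) n) (∑ (u (- ½ + x)) n) ⟩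
    ∑ (u (½ + x)) n - ∑ (u (- ½ + x)) n
      ≡⟨ ∑-distrib-- (u (½ + x)) (u (- ½ + x)) n ⟩
    ∑ (λ k → u (½ + x) k - u (- ½ + x) k) n
      ≡⟨ ∑-cong step n ⟩
    centralExpansion (λ k → a (suc k) * fromℕ (suc k)) n x ∎
    where
    u : ℚ → ℕ → ℚ
    u y k = a (suc k) * centralFactorial y (suc k)
    step : ∀ k → u (½ + x) k - u (- ½ + x) k ≡ a (suc k) * fromℕ (suc k) * centralFactorial x k
    step k = begin
      a (suc k) * p - a (suc k) * q
        ≡⟨ solve 3 (λ a p q → a :* p :+ :- (a :* q) := a :* (p :+ :- q)) ≡.refl (a (suc k)) p q ⟩
      a (suc k) * (p - q)
        ≡⟨ cong (a (suc k) *_) (δ-centralFactorial k x) ⟩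
      a (suc k) * (fromℕ (suc k) * centralFactorial x k)
        ≡⟨ ℚₚ.*-assoc (a (suc k)) (fromℕ (suc k)) (centralFactorial x k) ⟨
      a (suc k) * fromℕ (suc k) * centralFactorial x k ∎
      where
      p = centralFactorial (½ + x) (suc k)
      q = centralFactorial (- ½ + x) (suc k)

  -- The analogue of reading off Taylor coefficients: the value at 0 gives the constant coefficient,
  -- and `δ` shifts the others down. By induction the shifted coefficients, multiplied by k+1,
  -- agree, and k+1 cancels.
  centralExpansion-unique : ∀ n a b → (∀ x → centralExpansion a n x ≡ centralExpansion b n x) →
    ∀ k → k < n → a k ≡ b k
  centralExpansion-unique (suc n) a b eq zero _ = begin
    a 0                            ≡⟨ centralExpansion-0 a n ⟨
    centralExpansion a (suc n) 0ℚ  ≡⟨ eq 0ℚ ⟩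
    centralExpansion b (suc n) 0ℚ  ≡⟨ centralExpansion-0 b n ⟩
    b 0                            ∎
  centralExpansion-unique (suc n) a b eq (suc k) (s≤s k<n) =
    *-cancelʳ-fromℕ k (centralExpansion-unique n
      (λ k → a (suc k) * fromℕ (suc k)) (λ k → b (suc k) * fromℕ (suc k)) δ-eq k k<n)
    where
    δ-eq : ∀ x → centralExpansion (λ k → a (suc k) * fromℕ (suc k)) n x ≡
                 centralExpansion (λ k → b (suc k) * fromℕ (suc k)) n x
    δ-eq x = begin
      centralExpansion (λ k → a (suc k) * fromℕ (suc k)) n x ≡⟨ δ-centralExpansion a n x ⟨
      δ (centralExpansion a (suc n)) x                       ≡⟨ cong₂ _-_ (eq (½ + x)) (eq (- ½ + x)) ⟩
      δ (centralExpansion b (suc n)) x                       ≡⟨ δ-centralExpansion b n x ⟩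
      centralExpansion (λ k → b (suc k) * fromℕ (suc k)) n x ∎

  -- Recurrences for the central factorial numbers.

  module _ {T : ℕ → ℕ → ℚ} (isT : IsCentralFactorialNumbers T) where
    open IsCentralFactorialNumbers isT

    -- Evaluate the expansion of x^(n+1) at 0. This removes the constant term of the Fubini-like
    -- polynomial, so that a factor x can be taken out.
    T[1+n,0]≡0 : ∀ n → T (suc n) 0 ≡ 0ℚ
    T[1+n,0]≡0 n = begin
      T (suc n) 0                                 ≡⟨ centralExpansion-0 (T (suc n)) (suc n) ⟨
      centralExpansion (T (suc n)) (2 ℕ.+ n) 0ℚ   ≡⟨ expansion (suc n) 0ℚ ⟨
      0ℚ ^ suc n                                  ≡⟨ ℚₚ.*-zeroˡ (0ℚ ^ n) ⟩
      0ℚ                                          ∎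

    -- Padding with vanishing coefficients gives different powers expansions of one common length,
    -- as the exchange of sums requires.
    ^-centralExpansion : ∀ {m n} → m < n → ∀ x → x ^ m ≡ centralExpansion (T m) n x
    ^-centralExpansion {m} m<n x = ≡.trans (expansion m x) (∑-extend m<n λ k m<k →
      ≡.trans (cong (_* centralFactorial x k) (vanishing m k m<k)) (ℚₚ.*-zeroˡ (centralFactorial x k)))

    T-recurrence : ∀ n k → k < suc n → T (suc n) (suc k) * fromℕ (suc k) ≡
      ∑ (λ j → (+ 1 / 4) ^ j * ((suc n C suc (2 ℕ.* j)) × T (n ∸ 2 ℕ.* j) k)) (suc ⌊ n /2⌋)
    T-recurrence n = centralExpansion-unique (suc n) _ _ λ x → begin
      centralExpansion (λ k → T (suc n) (suc k) * fromℕ (suc k)) (suc n) x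
        ≡⟨ δ-centralExpansion (T (suc n)) (suc n) x ⟨
      δ (centralExpansion (T (suc n)) (2 ℕ.+ n)) x
        ≡⟨ cong₂ _-_ (expansion (suc n) (½ + x)) (expansion (suc n) (- ½ + x)) ⟨
      δ (_^ suc n) x
        ≡⟨ δ-^ n x ⟩
      ∑ (λ j → (+ 1 / 4) ^ j * ((suc n C suc (2 ℕ.* j)) × x ^ (n ∸ 2 ℕ.* j))) (suc ⌊ n /2⌋)
        -- Truncated subtraction never exceeds n, so n+1 terms suffice for every j.
        ≡⟨ ∑-cong (λ j → cong (λ z → (+ 1 / 4) ^ j * ((suc n C suc (2 ℕ.* j)) × z))
             (^-centralExpansion (s≤s (ℕₚ.m∸n≤m n (2 ℕ.* j))) x)) (suc ⌊ n /2⌋) ⟩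
      ∑ (λ j → (+ 1 / 4) ^ j * ((suc n C suc (2 ℕ.* j)) × centralExpansion (T (n ∸ 2 ℕ.* j)) (suc n) x)) (suc ⌊ n /2⌋)
        ≡⟨ ∑-exchange ((+ 1 / 4) ^_) (λ j → suc n C suc (2 ℕ.* j)) (λ j → T (n ∸ 2 ℕ.* j))
             (centralFactorial x) (suc ⌊ n /2⌋) (suc n) ⟩
      _ ∎

    -- Multiply `T-recurrence` by k!: on the left k!(k+1) = (k+1)!, and on the right k! moves onto
    -- T(n-2j,k), which yields coefficients of Fubini-like polynomials on both sides.
    k!T-recurrence : ∀ n k → k < suc n → ((suc k) !) × T (suc n) (suc k) ≡
      ∑ (λ j → (+ 1 / 4) ^ j * ((suc n C suc (2 ℕ.* j)) × ((k !) × T (n ∸ 2 ℕ.* j) k))) (suc ⌊ n /2⌋)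
    k!T-recurrence n k k<1+n = begin
      (suc k ℕ.* k !) × t
        ≡⟨ cong (_× t) (ℕₚ.*-comm (suc k) (k !)) ⟩
      (k ! ℕ.* suc k) × t
        ≡⟨ ×-assocˡ t (k !) (suc k) ⟨
      (k !) × (suc k × t)
        ≡⟨ ×-congʳ (k !) (≡.trans (≡.sym (fromℕ-* (suc k) t)) (T-recurrence n k k<1+n)) ⟩
      (k !) × ∑ (λ j → u j * (c j × T (n ∸ 2 ℕ.* j) k)) m
        -- The multiple becomes a rational factor, which distributes over the sum, and is turned
        -- back inside `step`.
        ≡⟨ fromℕ-* (k !) _ ⟨
      ∑ (λ j → u j * (c j × T (n ∸ 2 ℕ.* j) k)) m * fromℕ (k !)
        ≡⟨ ℚₚ.*-comm _ (fromℕ (k !)) ⟩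
      fromℕ (k !) * ∑ (λ j → u j * (c j × T (n ∸ 2 ℕ.* j) k)) m
        ≡⟨ *-distribˡ-sum {m} (fromℕ (k !)) (λ j → u (toℕ j) * (c (toℕ j) × T (n ∸ 2 ℕ.* toℕ j) k)) ⟩
      ∑ (λ j → fromℕ (k !) * (u j * (c j × T (n ∸ 2 ℕ.* j) k))) m
        ≡⟨ ∑-cong step m ⟩
      ∑ (λ j → u j * (c j × ((k !) × T (n ∸ 2 ℕ.* j) k))) m ∎
      where
      t = T (suc n) (suc k)
      m = suc ⌊ n /2⌋
      u : ℕ → ℚ
      u j = (+ 1 / 4) ^ j
      c : ℕ → ℕ
      c j = suc n C suc (2 ℕ.* j)
      step : ∀ j → fromℕ (k !) * (u j * (c j × T (n ∸ 2 ℕ.* j) k)) ≡ u j * (c j × ((k !) × T (n ∸ 2 ℕ.* j) k))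
      step j = begin
        fromℕ (k !) * (u j * (c j × s))
          ≡⟨ solve 3 (λ a b c → a :* (b :* c) := b :* (a :* c)) ≡.refl (fromℕ (k !)) (u j) (c j × s) ⟩
        u j * (fromℕ (k !) * (c j × s))
          ≡⟨ cong (u j *_) (×-comm-* (c j) (fromℕ (k !)) s) ⟩
        u j * (c j × (fromℕ (k !) * s))
          ≡⟨ cong (λ z → u j * (c j × z)) (≡.trans (ℚₚ.*-comm (fromℕ (k !)) s) (fromℕ-* (k !) s)) ⟩
        u j * (c j × ((k !) × s)) ∎
        where s = T (n ∸ 2 ℕ.* j) k

-- Transfer to a ℚ-algebra and the recurrence for the polynomials.

module _ {c ℓ} (A : ℚ-Algebra c ℓ) where
  open ℚ-Algebra A renaming (zero to *-zero)
  open Morphism.RingMorphisms.IsRingHomomorphism fromℚ-homomorphism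
    using (⟦⟧-cong; +-homo; *-homo; 0#-homo; 1#-homo)
  open FiniteSum semiring
  private
    module ℚR = CommutativeRing ℚₚ.+-*-commutativeRing
    module ℚΣ = FiniteSum ℚR.semiring
    module ℚM = Mult ℚR.semiring
    module ℚE = Exp ℚR.semiring
  open Mult semiring using (×-congʳ; ×-assoc-*)
  open Sum semiring using (*-distribˡ-sum)
  open import Relation.Binary.Reasoning.Setoid setoid

  fromℚ-∑ : ∀ f n → fromℚ (ℚΣ.∑ f n) ≈ ∑ (λ i → fromℚ (f i)) n
  fromℚ-∑ f zero    = 0#-homo
  fromℚ-∑ f (suc n) = trans (+-homo _ _) (+-congˡ (fromℚ-∑ (λ i → f (suc i)) n))

  fromℚ-× : ∀ n q → fromℚ (n ℚM.× q) ≈ n × fromℚ q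
  fromℚ-× zero    q = 0#-homo
  fromℚ-× (suc n) q = trans (+-homo _ _) (+-congˡ (fromℚ-× n q))

  fromℚ-^ : ∀ q n → fromℚ (q ℚE.^ n) ≈ fromℚ q ^ n
  fromℚ-^ q zero    = 1#-homo
  fromℚ-^ q (suc n) = trans (*-homo _ _) (*-congˡ (fromℚ-^ q n))

  module _ {T : ℕ → ℕ → ℚ} (isT : IsCentralFactorialNumbers T) where
    open IsCentralFactorialNumbers isT

    -- The coefficient of x^k in the n-th Fubini-like polynomial, formed in ℚ so that the rational
    -- recurrence can be carried over by `fromℚ`.
    coefficient : ℕ → ℕ → ℚ
    coefficient n k = (k !) ℚM.× T n k

    ×-fromℚ : ∀ n k x → (k !) × (fromℚ (T n k) * x ^ k) ≈ fromℚ (coefficient n k) * x ^ k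
    ×-fromℚ n k x = trans (sym (×-assoc-* (k !) _ _)) (*-congʳ (sym (fromℚ-× (k !) (T n k))))

    fromℚ-zero : ∀ {q} y → q ≡ ℚ.0ℚ → fromℚ q * y ≈ 0#
    fromℚ-zero y q≡0 = trans (*-congʳ (trans (⟦⟧-cong q≡0) 0#-homo)) (zeroˡ y)

    -- Past k = m the numbers T(m,k) vanish, so polynomials of different degrees can be summed over
    -- one range of k.
    centralFubini-∑ : ∀ {m n} → m < n → ∀ x →
      centralFubini A T m x ≈ ∑ (λ k → fromℚ (coefficient m k) * x ^ k) n
    centralFubini-∑ {m} m<n x = trans (∑-cong (λ k → ×-fromℚ m k x) (suc m))
      (∑-extend m<n λ k m<k → fromℚ-zero (x ^ k) (≡.trans (ℚM.×-congʳ (k !) (vanishing m k m<k)) (×-0ℚ (k !))))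
      where
      ×-0ℚ : ∀ n → n ℚM.× ℚ.0ℚ ≡ ℚ.0ℚ
      ×-0ℚ n = ≡.trans (≡.sym (fromℕ-* n ℚ.0ℚ)) (ℚₚ.*-zeroˡ (fromℕ n))

    centralFubini-recurrence : ∀ n x → centralFubini A T (suc n) x ≈
      x * ∑ (λ j → fromℚ (+ 1 / 4) ^ j * ((suc n C suc (2 ℕ.* j)) × centralFubini A T (n ∸ 2 ℕ.* j) x)) (suc ⌊ n /2⌋)
    centralFubini-recurrence n x = begin
      centralFubini A T (suc n) x
        ≈⟨ centralFubini-∑ ℕₚ.≤-refl x ⟩
      fromℚ (coefficient (suc n) 0) * 1# + ∑ (λ k → fromℚ (coefficient (suc n) (suc k)) * (x * x ^ k)) (suc n)
        -- The constant term vanishes because T(n+1,0) = 0; the factor `1#` is x^0.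
        ≈⟨ +-congʳ (fromℚ-zero 1# (≡.trans (ℚM.×-homo-1 (T (suc n) 0)) (T[1+n,0]≡0 isT n))) ⟩
      0# + ∑ (λ k → fromℚ (coefficient (suc n) (suc k)) * (x * x ^ k)) (suc n)
        ≈⟨ +-identityˡ _ ⟩
      ∑ (λ k → fromℚ (coefficient (suc n) (suc k)) * (x * x ^ k)) (suc n)
        -- One x comes out of x^(k+1). The coefficient recurrence asks for k < n+1, hence the
        -- bounded congruence.
        ≈⟨ ∑-cong-< (suc n) (λ k k<1+n → trans (*-comm-assoc _ x (x ^ k))
             (*-congˡ (*-congʳ (trans (⟦⟧-cong (k!T-recurrence isT n k k<1+n)) (fromℚ-recurrence k))))) ⟩
      ∑ (λ k → x * (∑ (λ j → u j * (c′ j × s j k)) m * x ^ k)) (suc n)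
        ≈⟨ *-distribˡ-sum {suc n} x (λ k → ∑ (λ j → u j * (c′ j × s j (toℕ k))) m * x ^ toℕ k) ⟨
      x * ∑ (λ k → ∑ (λ j → u j * (c′ j × s j k)) m * x ^ k) (suc n)
        ≈⟨ *-congˡ (∑-exchange u c′ s (x ^_) m (suc n)) ⟨
      x * ∑ (λ j → u j * (c′ j × ∑ (λ k → s j k * x ^ k) (suc n))) m
        ≈⟨ *-congˡ (∑-cong (λ j → *-congˡ {u j} (×-congʳ (c′ j)
             (centralFubini-∑ (s≤s (ℕₚ.m∸n≤m n (2 ℕ.* j))) x))) m) ⟨
      x * ∑ (λ j → u j * (c′ j × centralFubini A T (n ∸ 2 ℕ.* j) x)) m ∎
      where
      m = suc ⌊ n /2⌋
      u : ℕ → Carrier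
      u j = fromℚ (+ 1 / 4) ^ j
      c′ : ℕ → ℕ
      c′ j = suc n C suc (2 ℕ.* j)
      s : ℕ → ℕ → Carrier
      s j k = fromℚ (coefficient (n ∸ 2 ℕ.* j) k)
      *-comm-assoc : ∀ a b d → a * (b * d) ≈ b * (a * d)
      *-comm-assoc a b d = trans (sym (*-assoc a b d)) (trans (*-congʳ (*-comm a b)) (*-assoc b a d))
      fromℚ-recurrence : ∀ k →
        fromℚ (ℚΣ.∑ (λ j → (+ 1 / 4) ℚE.^ j ℚ.* (c′ j ℚM.× coefficient (n ∸ 2 ℕ.* j) k)) m) ≈
        ∑ (λ j → u j * (c′ j × s j k)) m
      fromℚ-recurrence k = trans (fromℚ-∑ (λ j → (+ 1 / 4) ℚE.^ j ℚ.* (c′ j ℚM.× coefficient (n ∸ 2 ℕ.* j) k)) m)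
        (∑-cong (λ j → trans (*-homo _ _) (*-cong (fromℚ-^ (+ 1 / 4) j)
          (fromℚ-× (c′ j) (coefficient (n ∸ 2 ℕ.* j) k)))) m)

theorem11 : ∀ {c ℓ} (A : ℚ-Algebra c ℓ) (T : ℕ → ℕ → ℚ) → IsCentralFactorialNumbers T →
    let open ℚ-Algebra A in
    ∀ (n : ℕ) (x : Carrier) →
    centralFubini A T (suc n) x ≈
    x * (∑[ k ≤ ⌊ n /2⌋ ] (fromℚ (+ 1 / 4) ^ toℕ k * ((suc n C suc (2 ℕ.* toℕ k)) × centralFubini A T (n ∸ 2 ℕ.* toℕ k) x)))
theorem11 A T isT = centralFubini-recurrence A isT
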